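{- Let $\vdash_0$ be the proof system consisting of the rules (axiom), (structural), (res), and (rel). Then $\vdash_0$ is sound and complete for $\mathcal{L}_4^+$; that is, for every theory $\Gamma$ and every sentence $\varphi$ of $\mathcal{L}_4^+$, $\Gamma\vdash_0\varphi$ if and only if $\Gamma\models\varphi$.
   Context: Syntax of $\mathcal{L}_4^+$. Fix a set $P$ of nouns and a set $R$ of verbs. Terms: every noun is a term; if $x$ is a term and $r\in R$ then $(r\ \mathsf{all}\ x)$ and $\overline{x}$ are terms. Sentences: $[x_1,\dots,x_n]$ for all $n\ge1$ and terms $x_1,\dots,x_n$. A theory is a set of sentences. Semantics. A model $\mathcal{M}$ is a set $M$ (possibly empty) with $[\![p]\!]\subseteq M$ for $p\in P$ and $[\![r]\!]\subseteq M\times M$ for $r\in R$; $[\![r\ \mathsf{all}\ x]\!]=\{m\in M: m\,[\![r]\!]\,n\text{ for all }n\in[\![x]\!]\}$; $[\![\overline{x}]\!]=M\setminus[\![x]\!]$. $\mathcal{M}\models[x_1,\dots,x_n]$ iff $\bigcap_{i=1}^n[\![x_i]\!]=\emptyset$. $\Gamma\models\varphi$ means every model of $\Gamma$ satisfies $\varphi$. Rules: (axiom) infer $[x,\overline{x}]$ from no premises; (structural) from $[x_1,\dots,x_m]$ infer $[y_1,\dots,y_n]$, provided each $x_i$ is identical to some $y_j$; (res) from $[x,y_1,\dots,y_n]$ and $[\overline{x},z_1,\dots,z_m]$ infer $[y_1,\dots,y_n,z_1,\dots,z_m]$ ($n$ or $m$ may be $0$ as long as the conclusion is a nonempty list); (rel)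 from $[\overline{x_1},\dots,\overline{x_{n-1}},x_n]$ infer $[(r\ \mathsf{all}\ x_1),\dots,(r\ \mathsf{all}\ x_{n-1}),\overline{(r\ \mathsf{all}\ x_n)}]$ ($n\ge1$). $\Gamma\vdash_0\varphi$ means there is a finite proof tree with root $\varphi$ in which each node is a leaf in $\Gamma$ or the conclusion, with its children the premises, of an instance of a rule. -}

module Defs where

open import Data.List.Base using (List; _∷_; _++_; map)
open import Data.List.NonEmpty.Base using (List⁺; _∷_; _∷ʳ_; toList)
open import Data.List.NonEmpty.Relation.Unary.All using (All)
open import Data.List.Relation.Binary.Subset.Propositional using (_⊆_)
open import Level using (Level; suc)
open import Relation.Binary.Core using (Rel)
open import Relation.Binary.PropositionalEquality.Core using (_≡_)
open import Relation.Unary using (Pred; _∈_; ∁; Empty)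

private
  variable
    ℓ : Level
    P R : Set ℓ

infix 9 ‾_
infixr 8 _all_
infix 4 _⊨ᴹ_ _⊨_ _⊢₀_

data Term (P R : Set ℓ) : Set ℓ where
  noun  : P → Term P R
  _all_ : R → Term P R → Term P R
  ‾_    : Term P R → Term P R

-- The nonempty list x₁ ∷ … ∷ xₙ is the sentence [x₁,…,xₙ].
Sentence : (P R : Set ℓ) → Set ℓ
Sentence P R = List⁺ (Term P R)

Theory : (P R : Set ℓ) → Set (suc ℓ)
Theory {ℓ} P R = Pred (Sentence P R) ℓ

-- Subsets and relations are arbitrary Set-valued predicates, so soundness of
-- rel already needs excluded middle: it deduces m r n from ¬ ¬ (m r n).
-- Completeness for arbitrary P also needs choice, which excluded middle
-- (for all types, untruncated) provides together with function
-- extensionality.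
record Model (P R : Set ℓ) : Set (suc ℓ) where
  field
    Carrier : Set ℓ
    nounᴹ   : P → Pred Carrier ℓ
    verbᴹ   : R → Rel Carrier ℓ

  ⟦_⟧ : Term P R → Pred Carrier ℓ
  ⟦ noun p ⟧ = nounᴹ p
  ⟦ r all x ⟧ m = ∀ n → n ∈ ⟦ x ⟧ → verbᴹ r m n
  ⟦ ‾ x ⟧ = ∁ ⟦ x ⟧

-- The set declared empty is the intersection of the ⟦ xᵢ ⟧.
_⊨ᴹ_ : {P R : Set ℓ} → Model P R → Sentence P R → Set ℓ
M ⊨ᴹ φ = Empty λ m → All (λ x → m ∈ ⟦ x ⟧) φ
  where open Model M

_⊨_ : {P R : Set ℓ} → Theory P R → Sentence P R → Set (suc ℓ)
_⊨_ {P = P} {R = R} Γ φ =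
  (M : Model P R) → (∀ ψ → ψ ∈ Γ → M ⊨ᴹ ψ) → M ⊨ᴹ φ

data _⊢₀_ {P R : Set ℓ} (Γ : Theory P R) : Sentence P R → Set ℓ where
  leaf       : ∀ {φ} → φ ∈ Γ → Γ ⊢₀ φ
  axiom      : ∀ x → Γ ⊢₀ x ∷ (‾ x ∷ List.[])
  structural : ∀ {φ ψ} → toList φ ⊆ toList ψ → Γ ⊢₀ φ → Γ ⊢₀ ψ
  -- Since φ is a nonempty list, the equation excludes only the case in
  -- which ys and zs are both empty.
  res        : ∀ {x ys zs φ} → toList φ ≡ ys ++ zs →
               Γ ⊢₀ x ∷ ys → Γ ⊢₀ ‾ x ∷ zs → Γ ⊢₀ φ
  -- xs is x₁,…,xₙ₋₁ (possibly empty) and x is xₙ.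
  rel        : ∀ r xs x → Γ ⊢₀ map ‾_ xs ∷ʳ x →
               Γ ⊢₀ map (r all_) xs ∷ʳ ‾ (r all x)

{-# OPTIONS --safe #-}
module Submission where

-- Soundness is an induction on derivations.
--
-- Completeness is a canonical-model argument.  Call a finite list of terms
-- refutable when prefixing any term to it gives a derivable sentence, and a
-- set of terms consistent when no finite list from it is refutable.  For
-- nonempty lists, refutable just means derivable, and the empty list is
-- refutable exactly when every sentence is derivable.  With this convention
-- (res) becomes a cut rule free of side conditions.
--
-- If φ is not derivable, its terms form a consistent set, which extends to a
-- maximal consistent set (maximal-extension).  The worlds of the canonical
-- model are all maximal consistent sets; S is related to T by r when T
-- contains some x with (r all x) in S.  By induction on terms, a world
-- satisfies exactly its own members (truth).  The one hard case is to find,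
-- when (r all x) is not in S, a world containing x to which S is not
-- related.  Such a world extends {x} together with all ‾ y for (r all y)
-- in S, and consistency of that set is exactly what (rel) provides
-- (counterexample-consistent).  All sentences of Γ then hold in the
-- canonical model, whereas φ fails at any world that contains its terms.
--
-- Since the nouns may form an arbitrary set, the maximal extension needs
-- choice.  Excluded middle applied to the type of terms that can be adjoined
-- consistently to S either produces such a term or shows that there is none,
-- which gives a step function on sets.  The sets reached from the initial
-- one by steps and unions form a chain (comparable), all of them are
-- consistent, and their union is a fixed point of the step function, hence
-- maximal.

open import Defs
open import Axiom.ExcludedMiddle using (ExcludedMiddle)
open import Axiom.Extensionality.Propositional
  using (Extensionality; lower-extensionality)
open import Data.Bool.Base using (Bool; T)
open import Data.Bool.Properties using (⇔→≡; T-≡; T?)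
open import Data.Empty using (⊥-elim)
open import Data.List.Base using (List; []; _∷_; _++_; map; [_])
open import Data.List.Membership.Propositional using () renaming (_∈_ to _∈ₗ_)
open import Data.List.Membership.Propositional.Properties using (∈-++⁺ˡ; ∈-++⁺ʳ)
open import Data.List.NonEmpty.Base using (_∷_; _∷ʳ_; toList)
open import Data.List.NonEmpty.Relation.Unary.All using (toList⁺; _∷_)
  renaming (All to All⁺)
open import Data.List.Relation.Binary.Subset.Propositional using (_⊆_)
open import Data.List.Relation.Binary.Subset.Propositional.Properties
  using (All-resp-⊇; ∷⁺ʳ; ∈-∷⁺ʳ; xs⊆x∷xs)
open import Data.List.Relation.Unary.All as All using (All; []; _∷_)
import Data.List.Relation.Unary.All.Properties as All
open import Data.List.Relation.Unary.Any using (here; there)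
open import Data.Product.Base using (Σ; Σ-syntax; ∃-syntax; _×_; _,_)
open import Data.Sum.Base using (_⊎_; inj₁; inj₂)
open import Function.Base using (_∘_; id)
open import Function.Bundles using (_⇔_; mk⇔; Equivalence)
open import Function.Properties.Equivalence using () renaming (trans to ⇔-trans; sym to ⇔-sym)
open import Level using (Level; 0ℓ; Lift; lift; lower)
open import Relation.Binary.PropositionalEquality.Core
  using (_≡_; refl; sym; subst)
open import Relation.Nullary using (¬_; Dec; yes; no; contradiction)
open import Relation.Nullary.Decidable
  using (⌊_⌋; toWitness; fromWitness; decidable-stable)
open import Relation.Unary using (Pred)

open Equivalence using (to; from)

private
  variable
    ℓ a q : Level
    A : Set a

-- Finite lists

module _ {Q : Pred A q} {x : A} where

  -- A list from {x} ∪ Q is covered by x and a list from Q.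
  All-split : ∀ {xs} → All (λ y → y ≡ x ⊎ Q y) xs →
              ∃[ ys ] All Q ys × xs ⊆ x ∷ ys
  All-split [] = [] , [] , λ ()
  All-split (inj₁ refl ∷ ps) with All-split ps
  ... | ys , qs , sub = ys , qs , ∈-∷⁺ʳ (here refl) sub
  All-split {z ∷ _} (inj₂ qz ∷ ps) with All-split ps
  ... | ys , qs , sub = z ∷ ys , qz ∷ qs , λ where
    (here refl) → there (here refl)
    (there m)   → ∷⁺ʳ x (xs⊆x∷xs ys z) (sub m)

toList-∷ʳ : ∀ (xs : List A) x → toList (xs ∷ʳ x) ≡ xs ++ [ x ]
toList-∷ʳ []       x = refl
toList-∷ʳ (_ ∷ xs) x = refl

module _ {Q : Pred A q} where

  toList⁻ : ∀ {φ} → All Q (toList φ) → All⁺ Q φ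
  toList⁻ (p ∷ ps) = p ∷ ps

  All-∷ʳ⁺ : ∀ {xs x} → All Q xs → Q x → All⁺ Q (xs ∷ʳ x)
  All-∷ʳ⁺ {xs} {x} ps p =
    toList⁻ (subst (All Q) (sym (toList-∷ʳ xs x)) (All.∷ʳ⁺ ps p))

  All-∷ʳ⁻ : ∀ xs {x} → All⁺ Q (xs ∷ʳ x) → All Q xs × Q x
  All-∷ʳ⁻ xs {x} ps = All.∷ʳ⁻ (subst (All Q) (toList-∷ʳ xs x) (toList⁺ ps))

∷⊆∷ʳ : ∀ (xs : List A) x → x ∷ xs ⊆ toList (xs ∷ʳ x)
∷⊆∷ʳ xs x {y} m = subst (y ∈ₗ_) (sym (toList-∷ʳ xs x)) (swap m)
  where
  swap : x ∷ xs ⊆ xs ++ [ x ]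
  swap (here eq)  = ∈-++⁺ʳ xs (here eq)
  swap (there m′) = ∈-++⁺ˡ m′

∷ʳ⊆∷ : ∀ (xs : List A) x → toList (xs ∷ʳ x) ⊆ x ∷ xs
∷ʳ⊆∷ xs x = All.lookup (toList⁺ (All-∷ʳ⁺ (All.tabulate there) (here refl)))

-- Maximal extensions for properties of finite character

-- A set is consistent when it contains no bad list.
Consistent : (Bad : Pred (List A) ℓ) → Pred A q → Set _
Consistent Bad Q = ∀ {xs} → All Q xs → ¬ Bad xs

module Maximal {ℓ} (em : ExcludedMiddle ℓ) (ext : Extensionality ℓ ℓ)
  {A : Set ℓ} (Bad : Pred (List A) ℓ)
  (Bad-mono : ∀ {xs ys} → xs ⊆ ys → Bad xs → Bad ys) where

  -- Subsets are Bool-valued, so that the type of all subsets is again in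
  -- Set ℓ; by excluded middle this loses no subset.
  Subset : Set ℓ
  Subset = A → Bool

  infix 4 _∈_ _⊑_

  _∈_ : A → Subset → Set
  x ∈ S = T (S x)

  _⊑_ : Subset → Subset → Set ℓ
  S ⊑ U = ∀ {x} → x ∈ S → x ∈ U

  -- Equality of sets matters because step depends on a choice, and so need
  -- not respect mutual inclusion without extensionality.
  ⊑-antisym : ∀ {S U} → S ⊑ U → U ⊑ S → S ≡ U
  ⊑-antisym S⊑U U⊑S =
    lower-extensionality 0ℓ ℓ ext λ x → ⇔→≡ (⇔-trans (⇔-sym T-≡) (⇔-trans (mk⇔ S⊑U U⊑S) T-≡))

  -- The Bool-valued form of a predicate.
  ⟪_⟫ : ∀ {B : Set ℓ} → Pred B ℓ → B → Bool
  ⟪ Q ⟫ x = ⌊ em {Q x} ⌋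

  ⟪⟫⁺ : ∀ {B : Set ℓ} (Q : Pred B ℓ) {x} → Q x → T (⟪ Q ⟫ x)
  ⟪⟫⁺ Q = fromWitness {a? = em}

  ⟪⟫⁻ : ∀ {B : Set ℓ} (Q : Pred B ℓ) {x} → T (⟪ Q ⟫ x) → Q x
  ⟪⟫⁻ Q = toWitness {a? = em}

  -- The elements outside S that can be added to S without making a list bad.
  Adjoinable : Subset → Pred A ℓ
  Adjoinable S x = ¬ x ∈ S × (∀ {ys} → All (_∈ S) ys → ¬ Bad (x ∷ ys))

  Insert : A → Subset → Pred A ℓ
  Insert x S y = y ≡ x ⊎ y ∈ S

  stepBy : (S : Subset) → Dec (Σ A (Adjoinable S)) → Subset
  stepBy S (yes (x , _)) = ⟪ Insert x S ⟫
  stepBy S (no _)        = S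

  -- Adjoin one adjoinable element, selected by excluded middle, if any.
  step : Subset → Subset
  step S = stepBy S em

  ⊑-step : ∀ S → S ⊑ step S
  ⊑-step S = go em
    where
    go : ∀ d → S ⊑ stepBy S d
    go (yes (x , _)) = ⟪⟫⁺ (Insert x S) ∘ inj₂
    go (no _)        = id

  step-consistent : ∀ S → Consistent Bad (_∈ S) → Consistent Bad (_∈ step S)
  step-consistent S con = go em
    where
    go : ∀ d → Consistent Bad (_∈ stepBy S d)
    go (yes (x , _ , adj)) ps bad with All-split (All.map (⟪⟫⁻ (Insert x S)) ps)
    ... | ys , ys∈S , sub = adj ys∈S (Bad-mono sub bad)
    go (no _) = con

  fixed⇒maximal : ∀ S → step S ⊑ S → ∀ x → ¬ Adjoinable S x
  fixed⇒maximal S = go em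
    where
    go : ∀ d → stepBy S d ⊑ S → ∀ x → ¬ Adjoinable S x
    go (yes (y , y∉S , _)) sub _ _   = y∉S (sub (⟪⟫⁺ (Insert y S) (inj₁ refl)))
    go (no none)           _   x adj = none (x , adj)

  -- Each element belongs to S or extends some list from S to a bad one.
  IsMaximal : Subset → Set ℓ
  IsMaximal S = ∀ x → x ∈ S ⊎ (∃[ ys ] All (_∈ S) ys × Bad (x ∷ ys))

  module _ (Base : Pred A ℓ) where

    ⋃-Member : (Subset → Bool) → Pred A ℓ
    ⋃-Member C x = Base x ⊎ (Σ[ S ∈ Subset ] T (C S) × x ∈ S)

    -- The union of a family of sets together with Base; the empty family
    -- yields Base itself.
    ⋃ : (Subset → Bool) → Subset
    ⋃ C = ⟪ ⋃-Member C ⟫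

    -- The sets obtained from Base by transfinite iteration of step.
    data Stage : Subset → Set ℓ where
      next  : ∀ {S} → Stage S → Stage (step S)
      limit : ∀ C → (∀ {S} → T (C S) → Stage S) → Stage (⋃ C)

    Base⊑ : ∀ {S} → Stage S → ∀ {x} → Base x → x ∈ S
    Base⊑ (next {S} s)  b = ⊑-step S (Base⊑ s b)
    Base⊑ (limit C _) b = ⟪⟫⁺ (⋃-Member C) (inj₁ b)

    ∈C⇒⊑⋃ : ∀ {C S} → T (C S) → S ⊑ ⋃ C
    ∈C⇒⊑⋃ {C} {S} S∈C x∈S = ⟪⟫⁺ (⋃-Member C) (inj₂ (S , S∈C , x∈S))

    ⋃-least : ∀ C {U} → Stage U → (∀ {S} → T (C S) → S ⊑ U) → ⋃ C ⊑ U
    ⋃-least C u sub x∈⋃ with ⟪⟫⁻ (⋃-Member C) x∈⋃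
    ... | inj₁ b               = Base⊑ u b
    ... | inj₂ (S , S∈C , x∈S) = sub S∈C x∈S

    -- Each stage either includes S or has its step included in S.
    Comparable : Subset → Set ℓ
    Comparable S = ∀ {U} → Stage U → S ⊑ U ⊎ step U ⊑ S

    -- No stage lies strictly between S and step S.
    no-stage-between : ∀ {S} → Stage S → Comparable S →
                       ∀ {U} → Stage U → S ⊑ U → step S ⊑ U ⊎ U ≡ S
    no-stage-between s cmp (next {V} v) S⊑stepV with cmp v
    ... | inj₂ stepV⊑S = inj₂ (⊑-antisym stepV⊑S S⊑stepV)
    ... | inj₁ S⊑V with no-stage-between s cmp v S⊑V
    ...   | inj₁ stepS⊑V = inj₁ (⊑-step V ∘ stepS⊑V)
    ...   | inj₂ refl    = inj₁ id
    no-stage-between {S} s cmp (limit C stages) S⊑⋃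
      with em {Σ[ V ∈ Subset ] T (C V) × step S ⊑ V}
    ... | yes (V , V∈C , stepS⊑V) = inj₁ (∈C⇒⊑⋃ {C} V∈C ∘ stepS⊑V)
    ... | no none = inj₂ (⊑-antisym (⋃-least C s below) S⊑⋃)
      where
      below : ∀ {V} → T (C V) → V ⊑ S
      below {V} V∈C with cmp (stages V∈C)
      ... | inj₂ stepV⊑S = stepV⊑S ∘ ⊑-step V
      ... | inj₁ S⊑V with no-stage-between s cmp (stages V∈C) S⊑V
      ...   | inj₁ stepS⊑V = ⊥-elim (none (V , V∈C , stepS⊑V))
      ...   | inj₂ refl    = id

    comparable : ∀ {S} → Stage S → Comparable S
    comparable (next {S} s) u with comparable s u
    ... | inj₂ stepU⊑S = inj₂ (⊑-step S ∘ stepU⊑S)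
    ... | inj₁ S⊑U with no-stage-between s (comparable s) u S⊑U
    ...   | inj₁ stepS⊑U = inj₁ stepS⊑U
    ...   | inj₂ refl    = inj₂ id
    comparable (limit C stages) {U} u
      with em {Σ[ V ∈ Subset ] T (C V) × step U ⊑ V}
    ... | yes (V , V∈C , stepU⊑V) = inj₂ (∈C⇒⊑⋃ {C} V∈C ∘ stepU⊑V)
    ... | no none = inj₁ (⋃-least C u below)
      where
      below : ∀ {V} → T (C V) → V ⊑ U
      below {V} V∈C with comparable (stages V∈C) u
      ... | inj₁ V⊑U     = V⊑U
      ... | inj₂ stepU⊑V = ⊥-elim (none (V , V∈C , stepU⊑V))

    total : ∀ {S U} → Stage S → Stage U → S ⊑ U ⊎ U ⊑ S
    total {U = U} s u with comparable s u
    ... | inj₁ S⊑U     = inj₁ S⊑U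
    ... | inj₂ stepU⊑S = inj₂ (stepU⊑S ∘ ⊑-step U)

    -- A finite part of the union of a family of stages lies in Base or in one
    -- member of the family, because stages are comparable.
    ⋃-compact : ∀ C → (∀ {S} → T (C S) → Stage S) → ∀ {xs} → All (_∈ ⋃ C) xs →
                All Base xs ⊎ (Σ[ S ∈ Subset ] T (C S) × All (_∈ S) xs)
    ⋃-compact C stages [] = inj₁ []
    ⋃-compact C stages (p ∷ ps) with ⟪⟫⁻ (⋃-Member C) p | ⋃-compact C stages ps
    ... | inj₁ b | inj₁ bs = inj₁ (b ∷ bs)
    ... | inj₁ b | inj₂ (S , S∈C , ms) = inj₂ (S , S∈C , Base⊑ (stages S∈C) b ∷ ms)
    ... | inj₂ (S , S∈C , m) | inj₁ bs =
      inj₂ (S , S∈C , m ∷ All.map (Base⊑ (stages S∈C)) bs)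
    ... | inj₂ (S , S∈C , m) | inj₂ (U , U∈C , ms)
      with total (stages S∈C) (stages U∈C)
    ...   | inj₁ S⊑U = inj₂ (U , U∈C , S⊑U m ∷ ms)
    ...   | inj₂ U⊑S = inj₂ (S , S∈C , m ∷ All.map U⊑S ms)

    stage-consistent : Consistent Bad Base → ∀ {S} → Stage S → Consistent Bad (_∈ S)
    stage-consistent con (next {S} s) = step-consistent S (stage-consistent con s)
    stage-consistent con (limit C stages) ps with ⋃-compact C stages ps
    ... | inj₁ bs             = con bs
    ... | inj₂ (_ , S∈C , ms) = stage-consistent con (stages S∈C) ms

    maximal-extension : Consistent Bad Base →
      Σ[ S ∈ Subset ] Consistent Bad (_∈ S) × IsMaximal S × (∀ {x} → Base x → x ∈ S)
    maximal-extension con =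
      top , stage-consistent con top-stage , top-maximal , Base⊑ top-stage
      where
      top : Subset
      top = ⋃ ⟪ Stage ⟫

      top-stage : Stage top
      top-stage = limit ⟪ Stage ⟫ (⟪⟫⁻ Stage)

      step-top⊑top : step top ⊑ top
      step-top⊑top = ∈C⇒⊑⋃ {⟪ Stage ⟫} (⟪⟫⁺ Stage (next top-stage))

      top-maximal : IsMaximal top
      top-maximal x with T? (top x)
      ... | yes x∈top = inj₁ x∈top
      ... | no x∉top with em {∃[ ys ] All (_∈ top) ys × Bad (x ∷ ys)}
      ...   | yes bad  = inj₂ bad
      ...   | no ¬bad =
        contradiction (x∉top , λ {ys} ms bad → ¬bad (ys , ms , bad))
                      (fixed⇒maximal top step-top⊑top x)

-- Soundness

module _ {ℓ} (em : ExcludedMiddle ℓ) {P R : Set ℓ} {Γ : Theory P R} where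

  sound : ∀ {φ} → Γ ⊢₀ φ → Γ ⊨ φ
  sound (leaf φ∈Γ) M M⊨Γ = M⊨Γ _ φ∈Γ
  sound (axiom x) M M⊨Γ m (p ∷ ¬p ∷ []) = ¬p p
  sound (structural sub d) M M⊨Γ m ps =
    sound d M M⊨Γ m (toList⁻ (All-resp-⊇ sub (toList⁺ ps)))
  sound (res {x} {ys} eq d e) M M⊨Γ m ps
    with All.++⁻ ys (subst (All _) eq (toList⁺ ps)) | em {Model.⟦_⟧ M x m}
  ... | ps₁ , ps₂ | yes p = sound d M M⊨Γ m (p ∷ ps₁)
  ... | ps₁ , ps₂ | no ¬p = sound e M M⊨Γ m (¬p ∷ ps₂)
  sound (rel r xs x d) M M⊨Γ m ps with All-∷ʳ⁻ (map (r all_) xs) ps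
  ... | allxs , ¬allx = ¬allx λ n n∈x → decidable-stable em λ ¬mrn →
    -- An n in x to which m is not related lies in no xᵢ.
    sound d M M⊨Γ n
      (All-∷ʳ⁺ (All.map⁺ (All.map (λ mall n∈xᵢ → ¬mrn (mall n n∈xᵢ))
                                  (All.map⁻ allxs)))
               n∈x)

-- Derivability of finite lists

module _ {ℓ} {P R : Set ℓ} (Γ : Theory P R) where

  -- Equivalent to derivability of the sentence formed by xs if xs is nonempty,
  -- and to derivability of every sentence if xs is empty.
  Refutable : Pred (List (Term P R)) ℓ
  Refutable xs = ∀ w → Γ ⊢₀ w ∷ xs

module _ {ℓ} {P R : Set ℓ} {Γ : Theory P R} where

  Refutable-mono : ∀ {xs ys} → xs ⊆ ys → Refutable Γ xs → Refutable Γ ys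
  Refutable-mono sub d w = structural (∷⁺ʳ w sub) (d w)

  ⊢₀⇒Refutable : ∀ {φ} → Γ ⊢₀ φ → Refutable Γ (toList φ)
  ⊢₀⇒Refutable {φ} d w = structural (xs⊆x∷xs (toList φ) w) d

  Refutable⇒⊢₀ : ∀ {φ} → Refutable Γ (toList φ) → Γ ⊢₀ φ
  Refutable⇒⊢₀ {x ∷ xs} d = structural (∈-∷⁺ʳ (here refl) id) (d x)

  cut : ∀ {x ys zs} → Refutable Γ (x ∷ ys) → Refutable Γ (‾ x ∷ zs) →
        Refutable Γ (ys ++ zs)
  cut {x} {ys} {zs} d e w =
    res refl (structural swap (d w)) (Refutable⇒⊢₀ e)
    where
    -- Keeping w in the first premise makes the conclusion nonempty.
    swap : w ∷ x ∷ ys ⊆ x ∷ w ∷ ys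
    swap = λ where
      (here eq)         → there (here eq)
      (there (here eq)) → here eq
      (there (there m)) → there (there m)

  Refutable-rel : ∀ r x ys → Refutable Γ (x ∷ map ‾_ ys) →
                  Refutable Γ (‾ (r all x) ∷ map (r all_) ys)
  Refutable-rel r x ys d =
    Refutable-mono (∷ʳ⊆∷ (map (r all_) ys) (‾ (r all x)))
      (⊢₀⇒Refutable (rel r ys x (Refutable⇒⊢₀
        (Refutable-mono (∷⊆∷ʳ (map ‾_ ys) x) d))))

-- The canonical model

module Canonical {ℓ} (em : ExcludedMiddle ℓ) (ext : Extensionality ℓ ℓ)
  {P R : Set ℓ} (Γ : Theory P R) where

  open Maximal em ext (Refutable Γ) Refutable-mono

  -- A maximal consistent set of terms.
  record World : Set ℓ where
    field
      members    : Subset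
      consistent : Consistent (Refutable Γ) (_∈ members)
      maximal    : IsMaximal members

  open World

  world-extending : (Base : Pred (Term P R) ℓ) → Consistent (Refutable Γ) Base →
    Σ[ W ∈ World ] (∀ {x} → Base x → x ∈ members W)
  world-extending Base con with maximal-extension Base con
  ... | S , con′ , max , sub =
    record { members = S ; consistent = con′ ; maximal = max } , sub

  module _ (S : World) where

    not-both : ∀ {x} → x ∈ members S → ¬ ‾ x ∈ members S
    not-both {x} p q = consistent S (p ∷ q ∷ []) (⊢₀⇒Refutable (axiom x))

    complement : ∀ {x} → ¬ x ∈ members S → ‾ x ∈ members S
    complement {x} x∉S with maximal S x | maximal S (‾ x)
    ... | inj₁ x∈S | _         = contradiction x∈S x∉S
    ... | inj₂ _   | inj₁ ‾x∈S = ‾x∈S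
    ... | inj₂ (ys , ys∈S , d) | inj₂ (zs , zs∈S , e) =
      ⊥-elim (consistent S (All.++⁺ ys∈S zs∈S) (cut d e))

    -- The set {x} ∪ {‾ y : (r all y) ∈ S}.  A world containing it has x as a
    -- member but is not an r-successor of S.
    Counterexample : R → Term P R → Pred (Term P R) ℓ
    Counterexample r x z =
      z ≡ x ⊎ (∃[ y ] z ≡ ‾ y × (r all y) ∈ members S)

    -- A list of such terms ‾ y arises from a list of the y.
    unmap-‾ : ∀ {r zs} → All (λ z → ∃[ y ] z ≡ ‾ y × (r all y) ∈ members S) zs →
            ∃[ ys ] zs ≡ map ‾_ ys × All (_∈ members S) (map (r all_) ys)
    unmap-‾ [] = [] , refl , []
    unmap-‾ ((y , refl , m) ∷ ps) with unmap-‾ ps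
    ... | ys , refl , ms = y ∷ ys , refl , m ∷ ms

    counterexample-consistent : ∀ {r x} → ¬ (r all x) ∈ members S →
      Consistent (Refutable Γ) (Counterexample r x)
    counterexample-consistent {r} {x} rx∉S ps d with All-split ps
    ... | zs , qs , sub with unmap-‾ qs
    ...   | ys , refl , ms =
      consistent S (complement rx∉S ∷ ms)
        (Refutable-rel r x ys (Refutable-mono sub d))

  -- Worlds are sets of terms; S is related to U by r when some x in U has
  -- (r all x) in S.
  canonical : Model P R
  canonical = record
    { Carrier = World
    ; nounᴹ   = λ p S → Lift ℓ (noun p ∈ members S)
    ; verbᴹ   = λ r S U → ∃[ x ] (r all x) ∈ members S × x ∈ members U
    }

  open Model canonical using (⟦_⟧)

  truth : ∀ x S → x ∈ members S ⇔ ⟦ x ⟧ S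
  truth (noun p) S = mk⇔ lift lower
  truth (‾ x) S = mk⇔
    (λ ‾x∈S p → not-both S (from (truth x S) p) ‾x∈S)
    (λ ¬p → complement S (¬p ∘ to (truth x S)))
  truth (r all x) S = mk⇔
    (λ rx∈S U p → x , rx∈S , from (truth x U) p)
    (λ related → decidable-stable (T? _) (refute related))
    where
    refute : ⟦ r all x ⟧ S → ¬ ¬ (r all x) ∈ members S
    refute related rx∉S with world-extending (Counterexample S r x)
                           (counterexample-consistent S rx∉S)
    ... | W , sub with related W (to (truth x W) (sub (inj₁ refl)))
    ...   | y , ry∈S , y∈W = not-both W y∈W (sub (inj₂ (y , refl , ry∈S)))

  canonical-⊨ : ∀ ψ → Γ ψ → canonical ⊨ᴹ ψ
  canonical-⊨ ψ ψ∈Γ S ps =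
    consistent S (All.map (λ {x} → from (truth x S)) (toList⁺ ps))
      (⊢₀⇒Refutable (leaf ψ∈Γ))

  complete : ∀ {φ} → Γ ⊨ φ → Γ ⊢₀ φ
  complete {φ} Γ⊨φ = decidable-stable em λ ¬d →
    let con : Consistent (Refutable Γ) (_∈ₗ toList φ)
        con ps d = ¬d (Refutable⇒⊢₀ (Refutable-mono (All.lookup ps) d))
        W , φ⊆W = world-extending (_∈ₗ toList φ) con
    in Γ⊨φ canonical canonical-⊨ W
         (toList⁻ (All.tabulate λ {x} m → to (truth x W) (φ⊆W m)))

corollary4p12 : ∀ {ℓ} → ExcludedMiddle ℓ → Extensionality ℓ ℓ →
    (P R : Set ℓ) (Γ : Theory P R) (φ : Sentence P R) →
    (Γ ⊢₀ φ) ⇔ (Γ ⊨ φ)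
corollary4p12 em ext P R Γ φ = mk⇔ (sound em) (Canonical.complete em ext Γ)
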